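{- For all integers $t,n\ge 2$ we have $R_{sep}(t,n)=2(t(n-1)+1)$.
   Context: The ordered complete graph on $[m]=\{1,\dots,m\}$ is the complete graph with vertex set $[m]$, taken with its natural ordering; edges are written $(i,j)$ with $i<j$. Two edges are independent if they share no vertex; independent edges $(a,b)$ and $(c,d)$ are separated if $a<b<c<d$ or $c<d<a<b$. A matching is a set of pairwise independent edges; it is separated if any two of its edges are separated, and monochromatic if all its edges have the same color. $R_{sep}(t,n)$ denotes the smallest $m$ such that in every coloring of the edges of the ordered complete graph on $[m]$ with $t$ colors there is a monochromatic separated matching with $n$ edges. -}

module Defs where

open import Data.Nat.Base using (ℕ; _≤_)
open import Data.Fin.Base using (Fin; _<_)
open import Data.List.Base using (List; length)
open import Data.List.Relation.Unary.AllPairs using (AllPairs)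
open import Data.Product.Base using (_×_; ∃-syntax)
open import Data.Sum.Base using (_⊎_)
open import Relation.Binary.PropositionalEquality.Core using (_≡_; _≢_)

-- The vertex set [m] = {1, …, m} is represented by Fin m, i.e. {0, …, m - 1},
-- with its natural order.  Proofs of left < right are unique, so an edge is
-- determined by its two endpoints.
record Edge (m : ℕ) : Set where
  constructor edge
  field
    left right : Fin m
    left<right : left < right

open Edge public

Independent : ∀ {m} → Edge m → Edge m → Set
Independent e f =
  left e ≢ left f × left e ≢ right f × right e ≢ left f × right e ≢ right f

-- The inequalities a < b and c < d inside a < b < c < d and c < d < a < b are
-- part of the edges (a , b) and (c , d) themselves.
Separated : ∀ {m} → Edge m → Edge m → Set
Separated e f = Independent e f × (right e < left f ⊎ right f < left e)

-- Finite sets of edges are lists.  No edge is independent of itself, so a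
-- matching has no repeated entries and its length is its number of edges.
-- All relations used with AllPairs below are symmetric, so the order of the
-- list is immaterial.
IsMatching : ∀ {m} → List (Edge m) → Set
IsMatching = AllPairs Independent

IsSeparated : ∀ {m} → List (Edge m) → Set
IsSeparated = AllPairs Separated

Coloring : ℕ → ℕ → Set
Coloring t m = Edge m → Fin t

IsMonochromatic : ∀ {t m} → Coloring t m → List (Edge m) → Set
IsMonochromatic χ = AllPairs (λ e f → χ e ≡ χ f)

HasMonoSepMatching : ∀ {t m} → Coloring t m → ℕ → Set
HasMonoSepMatching χ n =
  ∃[ M ] IsMatching M × IsSeparated M × IsMonochromatic χ M × length M ≡ n

IsLeast : (ℕ → Set) → ℕ → Set
IsLeast P m = P m × (∀ k → P k → m ≤ k)

-- IsRsep t n m says that R_sep(t, n) is defined and equal to m.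
IsRsep : ℕ → ℕ → ℕ → Set
IsRsep t n = IsLeast (λ m → (χ : Coloring t m) → HasMonoSepMatching χ n)

{-# OPTIONS --safe #-}

-- Upper bound: the consecutive pairs (1,2), (3,4), … form a separated matching
-- with t(n-1)+1 edges, so by pigeonhole n of them share a color.
--
-- Lower bound: on at most 2t(n-1)+1 vertices (numbered from 0), the half
-- ⌊ left e /2⌋ of every edge e is less than t(n-1).  Color e by the quotient of
-- its half by n-1.  Separated edges have distinct halves, so those of one color
-- have distinct remainders modulo n-1, and there are at most n-1 of them.

module Submission where

open import Defs
open import Data.Nat.Base using (ℕ; _≤_; _+_; _*_; _∸_)
open import Data.Nat.Base using (zero; suc; s≤s; s≤s⁻¹; ⌊_/2⌋) renaming (_<_ to _<ℕ_)
open import Data.Nat.Properties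
  using (_≟_; _<?_; ≤-refl; ≤-reflexive; ≤-trans; ≤∧≢⇒<; ≮⇒≥; <⇒≢; +-comm; +-identityʳ;
         +-cancelˡ-<; +-monoˡ-≤; +-monoʳ-<; *-comm; *-distribˡ-+; m≤n⇒m⊓n≡m; ⌊n/2⌋-mono; n≡⌈n+n/2⌉;
         module ≤-Reasoning)
open import Data.Fin.Base using (Fin; zero; suc; toℕ; fromℕ<; combine; remQuot; _<_)
open import Data.Fin.Properties as Fin
  using (toℕ<n; toℕ-injective; fromℕ<-injective; combine-monoˡ-<; combine-remQuot; toℕ-combine)
open import Data.List.Base using (List; length; lookup; filter; take; tabulate)
open import Data.List.Properties using (length-take; length-tabulate)
open import Data.List.Membership.Propositional.Properties using (∈-lookup)
open import Data.List.Relation.Ternary.Interleaving.Properties using (interleave-length)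
open import Data.List.Relation.Ternary.Interleaving.Propositional.Properties
  using () renaming (filter⁺ to filter-interleaving)
open import Data.List.Relation.Unary.All as All using (All; []; _∷_)
import Data.List.Relation.Unary.All.Properties as All
open import Data.List.Relation.Unary.AllPairs as AllPairs using (AllPairs; []; _∷_)
import Data.List.Relation.Unary.AllPairs.Properties as AllPairs
open import Data.Product.Base using (_×_; _,_; ∃-syntax; proj₁; proj₂; uncurry)
open import Data.Sum.Base using (inj₁; inj₂)
open import Function.Base using (_∘_)
open import Relation.Binary.Core using (Rel)
open import Relation.Binary.PropositionalEquality
  using (_≡_; _≢_; refl; sym; trans; cong; cong₂; subst)
open import Relation.Nullary using (¬_; yes; no; ¬?; contradiction)

module _ {a ℓ} {A : Set a} {R : Rel A ℓ} where

  lookup-AllPairs : ∀ {xs} → AllPairs R xs → ∀ {i j} → i < j → R (lookup xs i) (lookup xs j)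
  lookup-AllPairs (r ∷ _)  {zero}  {suc j} _   = All.lookup r (∈-lookup j)
  lookup-AllPairs (_ ∷ rs) {suc i} {suc j} i<j = lookup-AllPairs rs (s≤s⁻¹ i<j)

  -- Induction on `t`, removing the top value: if at most `p` entries take it, more than `t * p`
  -- entries with smaller values remain. Natural-number values let the bound drop without recoding,
  -- and `R` survives each filtering.
  pigeonhole-AllPairs : ∀ {p} (f : A → ℕ) t xs → All (λ x → f x <ℕ t) xs → AllPairs R xs →
    t * p <ℕ length xs →
    ∃[ c ] ∃[ ys ] All (λ y → f y ≡ c) ys × AllPairs R ys × p <ℕ length ys
  pigeonhole-AllPairs f zero (_ List.∷ _) (() ∷ _)
  pigeonhole-AllPairs {p} f (suc t) xs f<1+t rs tp<
    with p <? length (filter (λ x → f x ≟ t) xs)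
  ... | yes p< = t , _ , All.all-filter _ xs , AllPairs.filter⁺ _ rs , p<
  ... | no  p≮ = pigeonhole-AllPairs f t others f<t (AllPairs.filter⁺ _ rs) others>
    where
    others : List A
    others = filter (λ x → ¬? (f x ≟ t)) xs

    f<t : All (λ x → f x <ℕ t) others
    f<t = All.zipWith (λ (lt , ne) → ≤∧≢⇒< (s≤s⁻¹ lt) ne)
            (All.filter⁺ _ f<1+t , All.all-filter _ xs)

    others> : t * p <ℕ length others
    others> = +-cancelˡ-< p _ _ (begin-strict
      p + t * p                                              <⟨ tp< ⟩
      length xs                                              ≡⟨ interleave-length (filter-interleaving (λ x → f x ≟ t) xs) ⟩
      length (filter (λ x → f x ≟ t) xs) + length others     ≤⟨ +-monoˡ-≤ _ (≮⇒≥ p≮) ⟩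
      p + length others                                      ∎)
      where open ≤-Reasoning

length≤-AllPairs-≢ : ∀ {a} {A : Set a} {p} (f : A → Fin p) {xs} →
  AllPairs (λ x y → f x ≢ f y) xs → length xs ≤ p
length≤-AllPairs-≢ {p = p} f {xs} distinct = ≮⇒≥ λ p< →
  let _ , _ , i<j , eq = Fin.pigeonhole p< (f ∘ lookup xs)
  in lookup-AllPairs distinct i<j eq

All-≡⇒AllPairs-≡ : ∀ {a b} {A : Set a} {B : Set b} {f : A → B} {c xs} →
  All (λ x → f x ≡ c) xs → AllPairs (λ x y → f x ≡ f y) xs
All-≡⇒AllPairs-≡ []         = []
All-≡⇒AllPairs-≡ (eq ∷ eqs) = All.map (trans eq ∘ sym) eqs ∷ All-≡⇒AllPairs-≡ eqs

before⇒separated : ∀ {m} (e f : Edge m) → right e < left f → Separated e f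
before⇒separated (edge _ _ a<b) (edge _ _ c<d) b<c =
  (Fin.<⇒≢ a<c , Fin.<⇒≢ (Fin.<-trans a<c c<d) , Fin.<⇒≢ b<c , Fin.<⇒≢ (Fin.<-trans b<c c<d)) ,
  inj₁ b<c
  where a<c = Fin.<-trans a<b b<c

-- `combine` lays out the vertices in blocks of two, so the order of the indices `i` alone decides
-- that the pairs are separated.
consecutive : ∀ N → Fin N → Edge (N * 2)
consecutive N i = edge (combine i zero) (combine i (suc zero)) (begin-strict
  toℕ (combine i (zero {1}))  ≡⟨ toℕ-combine i zero ⟩
  2 * toℕ i + 0               <⟨ +-monoʳ-< (2 * toℕ i) ≤-refl ⟩
  2 * toℕ i + 1               ≡⟨ toℕ-combine i (suc zero) ⟨
  toℕ (combine i (suc zero))  ∎)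
  where open ≤-Reasoning

hasMonoSepMatching : ∀ t p (χ : Coloring t ((t * p + 1) * 2)) → HasMonoSepMatching χ (suc p)
hasMonoSepMatching t p χ
  using pair ← consecutive (t * p + 1)
  with c , M , mono , sep , p< ← pigeonhole-AllPairs {R = Separated} {p = p} (toℕ ∘ χ) t
         (tabulate pair)
         (All.universal (toℕ<n ∘ χ) _)
         (AllPairs.tabulate⁺-< λ {i} {j} i<j →
           before⇒separated (pair i) (pair j) (combine-monoˡ-< (suc zero) zero i<j))
         (≤-reflexive (trans (+-comm 1 (t * p)) (sym (length-tabulate pair))))
  -- The color class may be larger than needed; sublists keep all the properties.
  = take (suc p) M
  , AllPairs.map proj₁ sep′
  , sep′
  , AllPairs.map toℕ-injective (All-≡⇒AllPairs-≡ (All.take⁺ (suc p) mono))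
  , trans (length-take (suc p) M) (m≤n⇒m⊓n≡m p<)
  where sep′ = AllPairs.take⁺ (suc p) sep

half : ∀ {m} → Edge m → ℕ
half e = ⌊ toℕ (left e) /2⌋

-- The vertex `right e` lies strictly between the two left endpoints, so these differ by at least 2.
before⇒half< : ∀ {m} (e f : Edge m) → right e < left f → half e <ℕ half f
before⇒half< e f b<c = ⌊n/2⌋-mono (≤-trans (s≤s (left<right e)) b<c)

separated⇒half≢ : ∀ {m} (e f : Edge m) → Separated e f → half e ≢ half f
separated⇒half≢ e f (_ , inj₁ e<f) = <⇒≢ (before⇒half< e f e<f)
separated⇒half≢ e f (_ , inj₂ f<e) = <⇒≢ (before⇒half< f e f<e) ∘ sym

-- Among at most `2 * q + 1` vertices, only vertex `2 * q` could have half `q`; it would be the last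
-- one, which is never a left endpoint.
half-bound : ∀ {m} q → m <ℕ 2 * (q + 1) → (e : Edge m) → half e <ℕ q
half-bound {m} q m< e = begin
  suc (half e)       ≤⟨ ⌊n/2⌋-mono left+2≤ ⟩
  -- By definition this is the ceiling of half of `q + q`.
  ⌊ suc (q + q) /2⌋  ≡⟨ n≡⌈n+n/2⌉ q ⟨
  q                  ∎
  where
  open ≤-Reasoning
  left+2≤ : 2 + toℕ (left e) ≤ suc (q + q)
  left+2≤ = s≤s⁻¹ (begin
    3 + toℕ (left e)   ≤⟨ s≤s (s≤s (left<right e)) ⟩
    2 + toℕ (right e)  ≤⟨ s≤s (toℕ<n (right e)) ⟩
    suc m              ≤⟨ m< ⟩
    2 * (q + 1)        ≡⟨ *-distribˡ-+ 2 q 1 ⟩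
    2 * q + 2          ≡⟨ +-comm (2 * q) 2 ⟩
    2 + 2 * q          ≡⟨ cong (λ x → 2 + (q + x)) (+-identityʳ q) ⟩
    2 + (q + q)        ∎)

module BlockColoring t p {m} (m< : m <ℕ 2 * (t * p + 1)) where

  quotRem : Edge m → Fin t × Fin p
  quotRem e = remQuot {t} p (fromℕ< (half-bound (t * p) m< e))

  -- `combine` recovers the half from its quotient and remainder.
  quotRem≡⇒half≡ : ∀ e f → quotRem e ≡ quotRem f → half e ≡ half f
  quotRem≡⇒half≡ e f eq = fromℕ<-injective _ _ _ _
    (trans (sym (combine-remQuot {t} p _)) (trans (cong (uncurry combine) eq) (combine-remQuot {t} p _)))

  coloring : Coloring t m
  coloring = proj₁ ∘ quotRem

  noMonoSepMatching : ¬ HasMonoSepMatching coloring (suc p)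
  noMonoSepMatching (M , _ , sep , mono , len) =
    -- The length bound becomes `suc p ≤ p`.
    contradiction refl (<⇒≢ (subst (_≤ p) len (length≤-AllPairs-≢ (proj₂ ∘ quotRem) distinct)))
    where
    distinct : AllPairs (λ e f → proj₂ (quotRem e) ≢ proj₂ (quotRem f)) M
    distinct = AllPairs.zipWith
      -- Equal colors are equal quotients, so equal remainders would force equal halves.
      (λ {e} {f} (s , q≡) r≡ → separated⇒half≢ e f s (quotRem≡⇒half≡ e f (cong₂ _,_ q≡ r≡)))
      (sep , mono)

theorem2p19 : (t n : ℕ) → 2 ≤ t → 2 ≤ n → IsRsep t n (2 * (t * (n ∸ 1) + 1))
theorem2p19 t (suc p) _ _ =
  -- `combine` puts the factor 2 on the right of the vertex count.
  subst (λ m → (χ : Coloring t m) → HasMonoSepMatching χ (suc p)) (*-comm (t * p + 1) 2)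
    (hasMonoSepMatching t p) ,
  -- Any smaller `k` admits the block coloring.
  λ k hasMatching → ≮⇒≥ λ k< →
    let open BlockColoring t p k< in noMonoSepMatching (hasMatching coloring)
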